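{- Let $k\ge 3$ be a fixed integer. Almost all $k$-uniform hypergraphs are Seidel non-hypoenergetic; that is, for every fixed $p\in(0,1)$, if $\mathcal{H}\sim\mathcal{R}(n,k,p)$, then $$\mathbb{P}\big(\mathcal{E}(\mathcal{S}(\mathcal{H}))\ge n\big)\longrightarrow 1\quad\text{as } n\to\infty.$$
   Context: A $k$-uniform hypergraph $\mathcal{H}=(V,E)$ on $V=[n]=\{1,\dots,n\}$ has as hyperedge set $E$ a set of $k$-element subsets of $V$. For distinct vertices $i,j$, the co-degree is $c_{ij}=|\{e\in E: i,j\in e\}|$. The Seidel matrix $\mathcal{S}(\mathcal{H})$ is the real symmetric $n\times n$ matrix with $\mathcal{S}(\mathcal{H})_{ii}=0$ and $\mathcal{S}(\mathcal{H})_{ij}=1-2c_{ij}$ for $i\ne j$. If $\rho_1,\dots,\rho_n$ are its eigenvalues (with multiplicity), the Seidel energy is $\mathcal{E}(\mathcal{S}(\mathcal{H}))=\sum_{i=1}^n|\rho_i|$. A hypergraph $\mathcal{H}$ on $n$ vertices is Seidel hypoenergetic if $\mathcal{E}(\mathcal{S}(\mathcal{H}))<n$ and Seidel non-hypoenergetic if $\mathcal{E}(\mathcal{S}(\mathcal{H}))\ge n$. The random $k$-uniform hypergraph $\mathcal{R}(n,k,p)$ is the probability distribution on $k$-uniform hypergraphs with vertex set $[n]$ in which each of the $\binom{n}{k}$ $k$-subsets of $[n]$ is included as a hyperedge independently with probability $p$. "Almost all" means with probability tending to $1$ as $n\to\infty$ in this model. -}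

module Defs where

open import Algebra.Bundles.Raw using (RawRing)
import Algebra.Definitions.RawSemiring as RawSemiringDefinitions
open import Data.Bool.Base using (if_then_else_)
open import Data.Fin.Base using (Fin; zero; suc; toℕ; punchIn)
open import Data.Fin.Properties using (_≟_)
open import Data.Fin.Subset using (Subset; inside; outside; ∣_∣)
open import Data.Fin.Subset.Properties using (_∈?_)
open import Data.Integer.Base as ℤ using (ℤ; +_)
open import Data.List.Base as List
  using (List; []; _∷_; _++_; map; filter; foldr; length; allFin)
open import Data.Nat.Base as ℕ using (ℕ; zero; suc)
import Data.Nat.Properties as ℕₚ
open import Data.Product.Base using (∃-syntax; _×_; _,_)
open import Data.Rational.Base as ℚ using (ℚ; 0ℚ; 1ℚ; ½)
import Data.Rational.Properties as ℚₚ
open import Data.Rational.Solver using (module +-*-Solver)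
open import Data.Sum.Base using (inj₁; inj₂)
import Data.Vec.Base as Vec
open import Data.Vec.Functional using (Vector)
open import Level using (0ℓ)
open import Relation.Binary.PropositionalEquality
  using (_≡_; refl; sym; trans; cong; subst)
open import Relation.Nullary.Decidable.Core using (does; _×-dec_)
open import Relation.Unary using (Pred; Decidable)

private
  variable
    n k : ℕ

------------------------------------------------------------------------
-- Real numbers: Cauchy sequences of rationals, each carrying its modulus
-- of convergence, considered up to _≈_.

EventuallyWithin : (ℕ → ℚ) → ℚ → Set
EventuallyWithin x ε =
  ∃[ N ] ∀ i j → N ℕ.≤ i → N ℕ.≤ j → ℚ.∣ x i ℚ.- x j ∣ ℚ.< ε

Cauchy : (ℕ → ℚ) → Set
Cauchy x = ∀ ε → 0ℚ ℚ.< ε → EventuallyWithin x ε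

private

  EventuallyBounded : (ℕ → ℚ) → ℚ → Set
  EventuallyBounded x B = ∃[ N ] ∀ i → N ℕ.≤ i → ℚ.∣ x i ∣ ℚ.≤ B

  open ℚₚ.≤-Reasoning

private abstract

  0<½* : ∀ {ε} → 0ℚ ℚ.< ε → 0ℚ ℚ.< ½ ℚ.* ε
  0<½* {ε} 0<ε =
    subst (ℚ._< ½ ℚ.* ε) (ℚₚ.*-zeroʳ ½) (ℚₚ.*-monoʳ-<-pos ½ 0<ε)

  halves : ∀ ε → ½ ℚ.* ε ℚ.+ ½ ℚ.* ε ≡ ε
  halves ε = trans (sym (ℚₚ.*-distribʳ-+ ε ½ ½)) (ℚₚ.*-identityˡ ε)

  ⊔≤⇒≤ˡ : ∀ {M N i} → M ℕ.⊔ N ℕ.≤ i → M ℕ.≤ i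
  ⊔≤⇒≤ˡ {M} {N} = ℕₚ.≤-trans (ℕₚ.m≤m⊔n M N)

  ⊔≤⇒≤ʳ : ∀ {M N i} → M ℕ.⊔ N ℕ.≤ i → N ℕ.≤ i
  ⊔≤⇒≤ʳ {M} {N} = ℕₚ.≤-trans (ℕₚ.m≤n⊔m M N)

  p≤∣p∣ : ∀ p → p ℚ.≤ ℚ.∣ p ∣
  p≤∣p∣ p with ℚₚ.≤-total 0ℚ p
  ... | inj₁ 0≤p = ℚₚ.≤-reflexive (sym (ℚₚ.0≤p⇒∣p∣≡p 0≤p))
  ... | inj₂ p≤0 = ℚₚ.≤-trans p≤0 (ℚₚ.0≤∣p∣ p)

  ∣p∣≤q : ∀ {p q} → p ℚ.≤ q → ℚ.- p ℚ.≤ q → ℚ.∣ p ∣ ℚ.≤ q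
  ∣p∣≤q {p} p≤q -p≤q with ℚₚ.∣p∣≡p∨∣p∣≡-p p
  ... | inj₁ eq = subst (ℚ._≤ _) (sym eq) p≤q
  ... | inj₂ eq = subst (ℚ._≤ _) (sym eq) -p≤q

  ∣p∣-∣q∣≤∣p-q∣ : ∀ p q → ℚ.∣ p ∣ ℚ.- ℚ.∣ q ∣ ℚ.≤ ℚ.∣ p ℚ.- q ∣
  ∣p∣-∣q∣≤∣p-q∣ p q = begin
    ℚ.∣ p ∣ ℚ.- ℚ.∣ q ∣
      ≡⟨ cong (λ r → ℚ.∣ r ∣ ℚ.- ℚ.∣ q ∣) (lemma₁ p q) ⟩
    ℚ.∣ (p ℚ.- q) ℚ.+ q ∣ ℚ.- ℚ.∣ q ∣
      ≤⟨ ℚₚ.+-monoˡ-≤ (ℚ.- ℚ.∣ q ∣) (ℚₚ.∣p+q∣≤∣p∣+∣q∣ (p ℚ.- q) q) ⟩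
    (ℚ.∣ p ℚ.- q ∣ ℚ.+ ℚ.∣ q ∣) ℚ.- ℚ.∣ q ∣
      ≡⟨ lemma₂ ℚ.∣ p ℚ.- q ∣ ℚ.∣ q ∣ ⟩
    ℚ.∣ p ℚ.- q ∣ ∎
    where
    open +-*-Solver
    lemma₁ : ∀ a b → a ≡ (a ℚ.- b) ℚ.+ b
    lemma₁ = solve 2 (λ a b → a := (a :- b) :+ b) refl
    lemma₂ : ∀ a b → (a ℚ.+ b) ℚ.- b ≡ a
    lemma₂ = solve 2 (λ a b → (a :+ b) :- b := a) refl

  ∣p-q∣≡∣q-p∣ : ∀ p q → ℚ.∣ p ℚ.- q ∣ ≡ ℚ.∣ q ℚ.- p ∣
  ∣p-q∣≡∣q-p∣ p q =
    trans (cong ℚ.∣_∣ (lemma p q)) (ℚₚ.∣-p∣≡∣p∣ (q ℚ.- p))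
    where
    open +-*-Solver
    lemma : ∀ a b → a ℚ.- b ≡ ℚ.- (b ℚ.- a)
    lemma = solve 2 (λ a b → a :- b := :- (b :- a)) refl

  ∣∣p∣-∣q∣∣≤∣p-q∣ : ∀ p q → ℚ.∣ ℚ.∣ p ∣ ℚ.- ℚ.∣ q ∣ ∣ ℚ.≤ ℚ.∣ p ℚ.- q ∣
  ∣∣p∣-∣q∣∣≤∣p-q∣ p q = ∣p∣≤q (∣p∣-∣q∣≤∣p-q∣ p q) (begin
    ℚ.- (ℚ.∣ p ∣ ℚ.- ℚ.∣ q ∣)  ≡⟨ lemma ℚ.∣ p ∣ ℚ.∣ q ∣ ⟩
    ℚ.∣ q ∣ ℚ.- ℚ.∣ p ∣        ≤⟨ ∣p∣-∣q∣≤∣p-q∣ q p ⟩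
    ℚ.∣ q ℚ.- p ∣              ≡⟨ ∣p-q∣≡∣q-p∣ q p ⟩
    ℚ.∣ p ℚ.- q ∣              ∎)
    where
    open +-*-Solver
    lemma : ∀ a b → ℚ.- (a ℚ.- b) ≡ b ℚ.- a
    lemma = solve 2 (λ a b → :- (a :- b) := b :- a) refl

  const-cauchy : ∀ q → Cauchy (λ _ → q)
  const-cauchy q ε 0<ε = 0 , λ _ _ _ _ →
    subst (λ r → ℚ.∣ r ∣ ℚ.< ε) (sym (ℚₚ.+-inverseʳ q)) 0<ε

  +-cauchy : ∀ {x y} → Cauchy x → Cauchy y → Cauchy (λ i → x i ℚ.+ y i)
  +-cauchy {x} {y} cx cy ε 0<ε with cx _ (0<½* 0<ε) | cy _ (0<½* 0<ε)
  ... | M , px | N , py = M ℕ.⊔ N , λ i j i≥ j≥ → begin-strict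
    ℚ.∣ (x i ℚ.+ y i) ℚ.- (x j ℚ.+ y j) ∣
      ≡⟨ cong ℚ.∣_∣ (lemma (x i) (y i) (x j) (y j)) ⟩
    ℚ.∣ (x i ℚ.- x j) ℚ.+ (y i ℚ.- y j) ∣
      ≤⟨ ℚₚ.∣p+q∣≤∣p∣+∣q∣ (x i ℚ.- x j) (y i ℚ.- y j) ⟩
    ℚ.∣ x i ℚ.- x j ∣ ℚ.+ ℚ.∣ y i ℚ.- y j ∣
      <⟨ ℚₚ.+-mono-< (px i j (⊔≤⇒≤ˡ i≥) (⊔≤⇒≤ˡ j≥))
                     (py i j (⊔≤⇒≤ʳ {M} i≥) (⊔≤⇒≤ʳ {M} j≥)) ⟩
    ½ ℚ.* ε ℚ.+ ½ ℚ.* ε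
      ≡⟨ halves ε ⟩
    ε ∎
    where
    open +-*-Solver
    lemma : ∀ a b c d → (a ℚ.+ b) ℚ.- (c ℚ.+ d) ≡ (a ℚ.- c) ℚ.+ (b ℚ.- d)
    lemma = solve 4 (λ a b c d →
      (a :+ b) :- (c :+ d) := (a :- c) :+ (b :- d)) refl

  neg-cauchy : ∀ {x} → Cauchy x → Cauchy (λ i → ℚ.- x i)
  neg-cauchy {x} cx ε 0<ε with cx ε 0<ε
  ... | N , px = N , λ i j i≥ j≥ →
    subst (ℚ._< ε)
      (trans (sym (ℚₚ.∣-p∣≡∣p∣ (x i ℚ.- x j)))
             (cong ℚ.∣_∣ (ℚₚ.neg-distrib-+ (x i) (ℚ.- x j))))
      (px i j i≥ j≥)

  abs-cauchy : ∀ {x} → Cauchy x → Cauchy (λ i → ℚ.∣ x i ∣)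
  abs-cauchy {x} cx ε 0<ε with cx ε 0<ε
  ... | N , px = N , λ i j i≥ j≥ →
    ℚₚ.≤-<-trans (∣∣p∣-∣q∣∣≤∣p-q∣ (x i) (x j)) (px i j i≥ j≥)

  eventually-bounded : ∀ {x} → Cauchy x →
    ∃[ B ] 0ℚ ℚ.< B × EventuallyBounded x B
  eventually-bounded {x} cx with cx 1ℚ (ℚₚ.positive⁻¹ 1ℚ)
  ... | N , px = 1ℚ ℚ.+ ℚ.∣ x N ∣
               , ℚₚ.+-mono-<-≤ (ℚₚ.positive⁻¹ 1ℚ) (ℚₚ.0≤∣p∣ (x N))
               , N , λ i i≥ → begin
    ℚ.∣ x i ∣
      ≡⟨ cong ℚ.∣_∣ (lemma (x i) (x N)) ⟩
    ℚ.∣ (x i ℚ.- x N) ℚ.+ x N ∣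
      ≤⟨ ℚₚ.∣p+q∣≤∣p∣+∣q∣ (x i ℚ.- x N) (x N) ⟩
    ℚ.∣ x i ℚ.- x N ∣ ℚ.+ ℚ.∣ x N ∣
      ≤⟨ ℚₚ.+-monoˡ-≤ ℚ.∣ x N ∣ (ℚₚ.<⇒≤ (px i N i≥ ℕₚ.≤-refl)) ⟩
    1ℚ ℚ.+ ℚ.∣ x N ∣ ∎
    where
    open +-*-Solver
    lemma : ∀ a b → a ≡ (a ℚ.- b) ℚ.+ b
    lemma = solve 2 (λ a b → a := (a :- b) :+ b) refl

  -- For B > 0 and ε > 0 there is δ > 0 with B δ = ε.
  divide : ∀ {B ε} → 0ℚ ℚ.< B → 0ℚ ℚ.< ε →
           ∃[ δ ] 0ℚ ℚ.< δ × B ℚ.* δ ≡ ε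
  divide {B} {ε} 0<B 0<ε = ℚ.1/ B ℚ.* ε , 0<δ , Bδ≡ε
    where
    instance
      B-pos : ℚ.Positive B
      B-pos = ℚ.positive 0<B
      B-nonZero : ℚ.NonZero B
      B-nonZero = ℚₚ.pos⇒nonZero B
      1/B-pos : ℚ.Positive (ℚ.1/ B)
      1/B-pos = ℚₚ.1/pos⇒pos B
    0<δ : 0ℚ ℚ.< ℚ.1/ B ℚ.* ε
    0<δ = subst (ℚ._< ℚ.1/ B ℚ.* ε) (ℚₚ.*-zeroʳ (ℚ.1/ B))
                (ℚₚ.*-monoʳ-<-pos (ℚ.1/ B) 0<ε)
    Bδ≡ε : B ℚ.* (ℚ.1/ B ℚ.* ε) ≡ ε
    Bδ≡ε = trans (sym (ℚₚ.*-assoc B (ℚ.1/ B) ε))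
          (trans (cong (ℚ._* ε) (ℚₚ.*-inverseʳ B)) (ℚₚ.*-identityˡ ε))

  ∣p*q∣<ε : ∀ p q B δ ε → 0ℚ ℚ.< B → B ℚ.* δ ≡ ε →
            ℚ.∣ p ∣ ℚ.≤ B → ℚ.∣ q ∣ ℚ.< δ → ℚ.∣ p ℚ.* q ∣ ℚ.< ε
  ∣p*q∣<ε p q B δ ε 0<B eq p≤B q<δ = begin-strict
    ℚ.∣ p ℚ.* q ∣
      ≡⟨ ℚₚ.∣p*q∣≡∣p∣*∣q∣ p q ⟩
    ℚ.∣ p ∣ ℚ.* ℚ.∣ q ∣
      ≤⟨ ℚₚ.*-monoʳ-≤-nonNeg ℚ.∣ q ∣ {{ℚₚ.∣-∣-nonNeg q}} p≤B ⟩
    B ℚ.* ℚ.∣ q ∣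
      <⟨ ℚₚ.*-monoʳ-<-pos B {{ℚ.positive 0<B}} q<δ ⟩
    B ℚ.* δ
      ≡⟨ eq ⟩
    ε ∎

  expand : ∀ a b c d → (a ℚ.* b) ℚ.- (c ℚ.* d)
                     ≡ a ℚ.* (b ℚ.- d) ℚ.+ d ℚ.* (a ℚ.- c)
  expand = solve 4 (λ a b c d →
    (a :* b) :- (c :* d) := a :* (b :- d) :+ d :* (a :- c)) refl
    where open +-*-Solver

  ∣ab-cd∣<ε : ∀ a b c d ε →
    ℚ.∣ a ℚ.* (b ℚ.- d) ∣ ℚ.< ½ ℚ.* ε →
    ℚ.∣ d ℚ.* (a ℚ.- c) ∣ ℚ.< ½ ℚ.* ε →
    ℚ.∣ (a ℚ.* b) ℚ.- (c ℚ.* d) ∣ ℚ.< ε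
  ∣ab-cd∣<ε a b c d ε p q = begin-strict
    ℚ.∣ (a ℚ.* b) ℚ.- (c ℚ.* d) ∣
      ≡⟨ cong ℚ.∣_∣ (expand a b c d) ⟩
    ℚ.∣ a ℚ.* (b ℚ.- d) ℚ.+ d ℚ.* (a ℚ.- c) ∣
      ≤⟨ ℚₚ.∣p+q∣≤∣p∣+∣q∣ (a ℚ.* (b ℚ.- d)) (d ℚ.* (a ℚ.- c)) ⟩
    ℚ.∣ a ℚ.* (b ℚ.- d) ∣ ℚ.+ ℚ.∣ d ℚ.* (a ℚ.- c) ∣
      <⟨ ℚₚ.+-mono-< p q ⟩
    ½ ℚ.* ε ℚ.+ ½ ℚ.* ε
      ≡⟨ halves ε ⟩
    ε ∎

  *-within : ∀ x y A B α β ε → 0ℚ ℚ.< A → 0ℚ ℚ.< B →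
    A ℚ.* α ≡ ½ ℚ.* ε → B ℚ.* β ≡ ½ ℚ.* ε →
    EventuallyBounded x A → EventuallyBounded y B →
    EventuallyWithin x β → EventuallyWithin y α →
    EventuallyWithin (λ i → x i ℚ.* y i) ε
  *-within x y A B α β ε 0<A 0<B Aα Bβ (K , x≤A) (L , y≤B) (M , px) (N , py) =
    (K ℕ.⊔ L) ℕ.⊔ (M ℕ.⊔ N) , λ i j i≥ j≥ →
    ∣ab-cd∣<ε (x i) (y i) (x j) (y j) ε
      (∣p*q∣<ε (x i) (y i ℚ.- y j) A α (½ ℚ.* ε) 0<A Aα
         (x≤A i (⊔≤⇒≤ˡ {K} {L} (⊔≤⇒≤ˡ i≥)))
         (py i j (⊔≤⇒≤ʳ {M} {N} (⊔≤⇒≤ʳ {K ℕ.⊔ L} i≥))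
                 (⊔≤⇒≤ʳ {M} {N} (⊔≤⇒≤ʳ {K ℕ.⊔ L} j≥))))
      (∣p*q∣<ε (y j) (x i ℚ.- x j) B β (½ ℚ.* ε) 0<B Bβ
         (y≤B j (⊔≤⇒≤ʳ {K} {L} (⊔≤⇒≤ˡ j≥)))
         (px i j (⊔≤⇒≤ˡ {M} {N} (⊔≤⇒≤ʳ {K ℕ.⊔ L} i≥))
                 (⊔≤⇒≤ˡ {M} {N} (⊔≤⇒≤ʳ {K ℕ.⊔ L} j≥))))

  *-cauchy′ : ∀ {x y} → Cauchy x → Cauchy y →
    (∃[ A ] 0ℚ ℚ.< A × EventuallyBounded x A) →
    (∃[ B ] 0ℚ ℚ.< B × EventuallyBounded y B) →
    Cauchy (λ i → x i ℚ.* y i)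
  *-cauchy′ {x} {y} cx cy (A , 0<A , x≤A) (B , 0<B , y≤B) ε 0<ε =
    choose (divide 0<A (0<½* 0<ε)) (divide 0<B (0<½* 0<ε))
    where
    choose : (∃[ α ] 0ℚ ℚ.< α × A ℚ.* α ≡ ½ ℚ.* ε) →
             (∃[ β ] 0ℚ ℚ.< β × B ℚ.* β ≡ ½ ℚ.* ε) →
             EventuallyWithin (λ i → x i ℚ.* y i) ε
    choose (α , 0<α , Aα) (β , 0<β , Bβ) =
      *-within x y A B α β ε 0<A 0<B Aα Bβ x≤A y≤B (cx β 0<β) (cy α 0<α)

  *-cauchy : ∀ {x y} → Cauchy x → Cauchy y → Cauchy (λ i → x i ℚ.* y i)
  *-cauchy {x} {y} cx cy =
    *-cauchy′ {x} {y} cx cy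
      (eventually-bounded {x} cx) (eventually-bounded {y} cy)

record ℝ : Set where
  constructor mkℝ
  field
    seq    : ℕ → ℚ
    cauchy : Cauchy seq

open ℝ public

infix  4 _≈ᴿ_ _≤ᴿ_ _<ᴿ_
infixl 6 _+ᴿ_ _-ᴿ_
infixl 7 _*ᴿ_
infix  8 -ᴿ_

_≈ᴿ_ : ℝ → ℝ → Set
x ≈ᴿ y = ∀ ε → 0ℚ ℚ.< ε →
  ∃[ N ] ∀ i → N ℕ.≤ i → ℚ.∣ seq x i ℚ.- seq y i ∣ ℚ.< ε

_≤ᴿ_ : ℝ → ℝ → Set
x ≤ᴿ y = ∀ ε → 0ℚ ℚ.< ε →
  ∃[ N ] ∀ i → N ℕ.≤ i → seq x i ℚ.< seq y i ℚ.+ ε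

_<ᴿ_ : ℝ → ℝ → Set
x <ᴿ y = ∃[ ε ] 0ℚ ℚ.< ε ×
  ∃[ N ] ∀ i → N ℕ.≤ i → seq x i ℚ.+ ε ℚ.< seq y i

fromℚ : ℚ → ℝ
fromℚ q = mkℝ (λ _ → q) (const-cauchy q)

fromℤ : ℤ → ℝ
fromℤ z = fromℚ (z ℚ./ 1)

fromℕ : ℕ → ℝ
fromℕ m = fromℤ (+ m)

0ᴿ 1ᴿ : ℝ
0ᴿ = fromℚ 0ℚ
1ᴿ = fromℚ 1ℚ

_+ᴿ_ _*ᴿ_ : ℝ → ℝ → ℝ
x +ᴿ y = mkℝ (λ i → seq x i ℚ.+ seq y i)
  (+-cauchy {seq x} {seq y} (cauchy x) (cauchy y))
x *ᴿ y = mkℝ (λ i → seq x i ℚ.* seq y i)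
  (*-cauchy {seq x} {seq y} (cauchy x) (cauchy y))

-ᴿ_ : ℝ → ℝ
-ᴿ x = mkℝ (λ i → ℚ.- seq x i) (neg-cauchy {seq x} (cauchy x))

_-ᴿ_ : ℝ → ℝ → ℝ
x -ᴿ y = x +ᴿ (-ᴿ y)

∣_∣ᴿ : ℝ → ℝ
∣ x ∣ᴿ = mkℝ (λ i → ℚ.∣ seq x i ∣) (abs-cauchy {seq x} (cauchy x))

ℝ-rawRing : RawRing 0ℓ 0ℓ
ℝ-rawRing = record
  { Carrier = ℝ
  ; _≈_     = _≈ᴿ_
  ; _+_     = _+ᴿ_
  ; _*_     = _*ᴿ_
  ; -_      = -ᴿ_
  ; 0#      = 0ᴿ
  ; 1#      = 1ᴿ
  }

infix 4 _⟶_

_⟶_ : (ℕ → ℝ) → ℝ → Set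
a ⟶ l = ∀ ε → 0ᴿ <ᴿ ε → ∃[ N ] ∀ n → N ℕ.≤ n → ∣ a n -ᴿ l ∣ᴿ <ᴿ ε

------------------------------------------------------------------------
-- Polynomials over a ring, as lists of coefficients with the constant
-- coefficient first.  Trailing zeros are allowed; equality compares all
-- coefficients.

module Polynomial {c ℓ} (R : RawRing c ℓ) where

  open RawRing R

  Poly : Set c
  Poly = List Carrier

  coeff : Poly → ℕ → Carrier
  coeff []      _       = 0#
  coeff (a ∷ p) zero    = a
  coeff (a ∷ p) (suc m) = coeff p m

  C : Carrier → Poly
  C a = a ∷ []

  X : Poly
  X = 0# ∷ 1# ∷ []

  infixl 6 _+ₚ_
  infixl 7 _*ₚ_

  _+ₚ_ : Poly → Poly → Poly
  []      +ₚ q       = q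
  (a ∷ p) +ₚ []      = a ∷ p
  (a ∷ p) +ₚ (b ∷ q) = (a + b) ∷ (p +ₚ q)

  _*ₚ_ : Poly → Poly → Poly
  []      *ₚ q = []
  (a ∷ p) *ₚ q = map (a *_) q +ₚ (0# ∷ (p *ₚ q))

  polyRing : RawRing c ℓ
  polyRing = record
    { Carrier = Poly
    ; _≈_     = λ p q → ∀ m → coeff p m ≈ coeff q m
    ; _+_     = _+ₚ_
    ; _*_     = _*ₚ_
    ; -_      = map -_
    ; 0#      = []
    ; 1#      = C 1#
    }

------------------------------------------------------------------------
-- Matrices over a ring

module Matrix {c ℓ} (R : RawRing c ℓ) where

  open RawRing R
  open RawSemiringDefinitions rawSemiring using (sum; product; _^_)

  SquareMatrix : ℕ → Set c
  SquareMatrix n = Fin n → Fin n → Carrier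

  -- Laplace expansion along the first row.
  det : ∀ {n} → SquareMatrix n → Carrier
  det {zero}  A = 1#
  det {suc n} A = sum λ j →
    (- 1#) ^ toℕ j * (A zero j * det (λ r s → A (suc r) (punchIn j s)))

module CharacteristicPolynomial {c ℓ} (R : RawRing c ℓ) where

  open RawRing R using (Carrier)
  open Matrix R using (SquareMatrix)
  open Polynomial R
  open RawRing polyRing using (_≈_; _+_; -_; 0#; rawSemiring)
  open RawSemiringDefinitions rawSemiring using (product)

  charpoly : SquareMatrix n → Poly
  charpoly A =
    Matrix.det polyRing λ i j → (if does (i ≟ j) then X else 0#) + (- C (A i j))

  -- ρ lists the eigenvalues of A, each repeated according to its
  -- (algebraic) multiplicity: det (X I - A) = ∏ᵢ (X - ρᵢ).
  Eigenvalues : SquareMatrix n → Vector Carrier n → Set ℓ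
  Eigenvalues A ρ = charpoly A ≈ product (λ i → X + (- C (ρ i)))

open Matrix ℝ-rawRing using (SquareMatrix)
open CharacteristicPolynomial ℝ-rawRing using (Eigenvalues)

------------------------------------------------------------------------
-- Uniform hypergraphs

-- Every subset of Fin n, listed exactly once.
allSubsets : ∀ n → List (Subset n)
allSubsets zero    = Vec.[] ∷ []
allSubsets (suc n) =
  map (inside Vec.∷_) (allSubsets n) ++ map (outside Vec.∷_) (allSubsets n)

kSubsets : ∀ n k → List (Subset n)
kSubsets n k = filter (λ e → ∣ e ∣ ℕₚ.≟ k) (allSubsets n)

-- A set of k-element subsets of Fin n, given as a set of positions in
-- the list of all of them.
Hypergraph : ℕ → ℕ → Set
Hypergraph n k = Subset (length (kSubsets n k))

edges : Hypergraph n k → List (Subset n)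
edges {n} {k} H = map (List.lookup (kSubsets n k)) (filter (_∈? H) (allFin _))

codegree : Hypergraph n k → Fin n → Fin n → ℕ
codegree {n} {k} H i j =
  length (filter (λ e → (i ∈? e) ×-dec (j ∈? e)) (edges {n} {k} H))

seidel : Hypergraph n k → SquareMatrix n
seidel {n} {k} H i j =
  if does (i ≟ j) then 0ᴿ
  else fromℤ (ℤ.1ℤ ℤ.- + (2 ℕ.* codegree {n} {k} H i j))

------------------------------------------------------------------------
-- Seidel energy

open RawSemiringDefinitions (RawRing.rawSemiring ℝ-rawRing)
  using () renaming (sum to ∑)

-- E is the Seidel energy of H.  A relation, since extracting the
-- eigenvalues of a symmetric matrix as a function would need a
-- constructive proof of the spectral theorem.
IsSeidelEnergy : Hypergraph n k → ℝ → Set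
IsSeidelEnergy {n} {k} H E =
  ∃[ ρ ] Eigenvalues (seidel {n} {k} H) ρ × E ≈ᴿ ∑ (λ i → ∣ ρ i ∣ᴿ)

SeidelNonHypoenergetic : ∀ n k → Pred (Hypergraph n k) 0ℓ
SeidelNonHypoenergetic n k H =
  ∀ E → IsSeidelEnergy {n} {k} H E → fromℕ n ≤ᴿ E

------------------------------------------------------------------------
-- The random hypergraph R(n,k,p)

-- The probability of drawing H: a factor p for every k-subset that is a
-- hyperedge and a factor 1 - p for every k-subset that is not.
weight : ℝ → ∀ {N} → Subset N → ℝ
weight p = Vec.foldr _ (λ e∈H w → (if e∈H then p else 1ᴿ -ᴿ p) *ᴿ w) 1ᴿ

-- The probability of an event.  A decision procedure stands in for the
-- indicator function; the result does not depend on which one is used.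
ℙ : ∀ n k → ℝ → {A : Pred (Hypergraph n k) 0ℓ} → Decidable A → ℝ
ℙ n k p A? = foldr _+ᴿ_ 0ᴿ (map (weight p) (filter A? (allSubsets _)))

{-# OPTIONS --safe #-}

-- The energy is at least n for every hypergraph on n ≥ 2 vertices, so the event
-- is certain.  If ρ lists the eigenvalues, then (∑ ρ)² ≤ (∑ |ρ|)² + 4 e₂(ρ), so
-- that (∑ |ρ|)² ≥ - 4 e₂(ρ).  Comparing the coefficients of degree n - 2 in
-- det (X I - S) = ∏ (X - ρᵢ) and using that S has zero diagonal,
-- - e₂(ρ) = ∑_{i<j} Sᵢⱼ Sⱼᵢ, which is at least n (n - 1) / 2 because the entries
-- off the diagonal are odd integers.  Hence (∑ |ρ|)² ≥ 2 n (n - 1) ≥ n².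
module Submission where

open import Defs
open import Algebra.Bundles using (CommutativeRing)
open import Algebra.Bundles.Raw using (RawRing)
import Algebra.Construct.Pointwise as Pointwise
import Algebra.Definitions.RawSemiring as RawSemiringDefinitions
import Algebra.Morphism.RingMonomorphism as RingMonomorphism
import Algebra.Properties.CommutativeMonoid.Sum as CommutativeMonoidSum
import Algebra.Properties.Ring as RingProperties
open import Algebra.Structures using (IsCommutativeRing)
open import Data.Bool.Base using (if_then_else_)
open import Data.Fin.Base using (Fin; zero; suc; toℕ; punchIn)
open import Data.Fin.Properties using (_≟_; punchInᵢ≢i; suc-injective)
open import Data.Fin.Subset using (Subset; inside; outside)
open import Data.Fin.Subset.Properties using (_∈?_)
open import Data.Integer.Base as ℤ using (+_; +0; +[1+_]; -[1+_])
import Data.Integer.Properties as ℤₚ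
open import Data.List.Base using (List; []; _∷_; _++_; map; foldr; length)
open import Data.List.Properties using (filter-≐; filter-all)
open import Data.List.Relation.Unary.All using (universal)
open import Data.Nat.Base as ℕ using (ℕ; zero; suc; z≤n; s≤s; _≤_)
import Data.Nat.Coprimality as Coprimality
import Data.Nat.Properties as ℕₚ
open import Data.Product.Base using (_×_; _,_; ∃-syntax; Σ-syntax; swap)
open import Data.Rational.Base as ℚ using (ℚ; mkℚ; 0ℚ; 1ℚ; ½)
import Data.Rational.Properties as ℚₚ
open import Data.Rational.Solver using (module +-*-Solver)
open import Data.Sum.Base using (inj₁; inj₂)
import Data.Vec.Base as Vec
open import Data.Vec.Functional using (Vector; tail)
open import Function.Base using (_∘_)
open import Relation.Binary.Core using (Rel)
open import Relation.Binary.PropositionalEquality as ≡ using (_≡_; _≢_)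
import Relation.Binary.Reasoning.Setoid as SetoidReasoning
open import Relation.Nullary.Decidable using (dec-false; dec-true)
open import Relation.Nullary.Decidable.Core using (does; yes; no; _×-dec_)
open import Relation.Nullary.Negation.Core using (¬_; contradiction)
open import Relation.Unary using (Decidable)

-- Leading coefficients of determinants of linear pencils

-- The equality _≋_ of coefficients is independent of the one bundled in R, so
-- that reals can be compared index by index, where the ring laws hold exactly.
module TopCoefficients {c ℓ₀ ℓ} (R : RawRing c ℓ₀)
  (_≋_ : Rel (RawRing.Carrier R) ℓ)
  (isCommutativeRing : IsCommutativeRing _≋_ (RawRing._+_ R) (RawRing._*_ R)
                         (RawRing.-_ R) (RawRing.0# R) (RawRing.1# R))
  where

  open RawRing R using (Carrier; _+_; _*_; -_; 0#; 1#)

  private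
    commutativeRing : CommutativeRing c ℓ
    commutativeRing = record { isCommutativeRing = isCommutativeRing }

  open CommutativeRing commutativeRing
    using ( setoid; ring; +-commutativeMonoid; refl; sym; trans; reflexive
          ; +-cong; +-congˡ; +-congʳ; +-comm; +-identityˡ; +-identityʳ
          ; *-cong; *-congˡ; *-congʳ; *-assoc; *-comm; *-identityˡ; *-identityʳ
          ; zeroˡ; zeroʳ; -‿cong )
  open RingProperties ring
    using (-‿distribˡ-*; -‿distribʳ-*; -1*x≈-x; -‿involutive; -0#≈0#; -‿+-comm)
  open CommutativeMonoidSum +-commutativeMonoid
    using (sum-cong-≋; sum-replicate-zero)
  open RawSemiringDefinitions (RawRing.rawSemiring R) using (sum; _^_)
  open Polynomial R
  open RawSemiringDefinitions (RawRing.rawSemiring polyRing)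
    using () renaming (sum to sumₚ; product to productₚ; _^_ to _^ₚ_)
  open RawRing polyRing using () renaming (-_ to -ₚ_; 1# to 1ₚ)
  open Matrix R using (SquareMatrix)
  open Matrix polyRing using (det) renaming (SquareMatrix to PolyMatrix)
  open CharacteristicPolynomial R using (charpoly)
  open SetoidReasoning setoid

  𝟙 : ∀ {n} → SquareMatrix n
  𝟙 i j = if does (i ≟ j) then 1# else 0#

  minor : ∀ {a} {A : Set a} {n} →
          (Fin (suc n) → Fin (suc n) → A) → Fin (suc n) → Fin n → Fin n → A
  minor A j r s = A (suc r) (punchIn j s)

  sign : ∀ {n} → Fin n → Carrier
  sign j = (- 1#) ^ toℕ j

  private

    x*0 : ∀ {x y} → y ≋ 0# → (x * y) ≋ 0#
    x*0 {x} y≋0 = trans (*-congˡ y≋0) (zeroʳ x)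

    0*x : ∀ {x y} → x ≋ 0# → (x * y) ≋ 0#
    0*x {y = y} x≋0 = trans (*-congʳ x≋0) (zeroˡ y)

    0+0 : ∀ {x y} → x ≋ 0# → y ≋ 0# → (x + y) ≋ 0#
    0+0 x≋0 y≋0 = trans (+-cong x≋0 y≋0) (+-identityˡ 0#)

    0+x : ∀ {x y} → x ≋ 0# → (x + y) ≋ y
    0+x {y = y} x≋0 = trans (+-congʳ x≋0) (+-identityˡ y)

    x+0 : ∀ {x y} → y ≋ 0# → (x + y) ≋ x
    x+0 {x} y≋0 = trans (+-congˡ y≋0) (+-identityʳ x)

    1*x : ∀ {x y} → x ≋ 1# → (x * y) ≋ y
    1*x {y = y} x≋1 = trans (*-congʳ x≋1) (*-identityˡ y)

    sum-zero : ∀ {n} (f : Vector Carrier n) → (∀ i → f i ≋ 0#) → sum f ≋ 0#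
    sum-zero {n} f f≋0 = trans (sum-cong-≋ f≋0) (sum-replicate-zero n)

    𝟙-≢ : ∀ {n} {i j : Fin n} → i ≢ j → 𝟙 i j ≋ 0#
    𝟙-≢ {i = i} {j} i≢j =
      reflexive (≡.cong (if_then 1# else 0#) (dec-false (i ≟ j) i≢j))

    -x*-y : ∀ x y → (- x * - y) ≋ (x * y)
    -x*-y x y = begin
      - x * - y      ≈⟨ -‿distribˡ-* x (- y) ⟨
      - (x * - y)    ≈⟨ -‿cong (-‿distribʳ-* x y) ⟨
      - (- (x * y))  ≈⟨ -‿involutive (x * y) ⟩
      x * y          ∎

    interchange : ∀ a b x y → ((a * x) * (b * y)) ≋ ((a * b) * (x * y))
    interchange a b x y = begin
      (a * x) * (b * y)  ≈⟨ *-assoc a x (b * y) ⟩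
      a * (x * (b * y))  ≈⟨ *-congˡ (*-assoc x b y) ⟨
      a * ((x * b) * y)  ≈⟨ *-congˡ (*-congʳ (*-comm x b)) ⟩
      a * ((b * x) * y)  ≈⟨ *-congˡ (*-assoc b x y) ⟩
      a * (b * (x * y))  ≈⟨ *-assoc a b (x * y) ⟨
      (a * b) * (x * y)  ∎

    sign² : ∀ m → ((- 1#) ^ m * (- 1#) ^ m) ≋ 1#
    sign² zero    = *-identityˡ 1#
    sign² (suc m) = begin
      (- 1# * (- 1#) ^ m) * (- 1# * (- 1#) ^ m)  ≈⟨ interchange _ _ _ _ ⟩
      (- 1# * - 1#) * ((- 1#) ^ m * (- 1#) ^ m)
        ≈⟨ *-cong (trans (-x*-y 1# 1#) (*-identityˡ 1#)) (sign² m) ⟩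
      1# * 1#                                    ≈⟨ *-identityˡ 1# ⟩
      1#                                         ∎

  -- Coefficients of sums and products of polynomials.

  coeff-+ₚ : ∀ p q l → coeff (p +ₚ q) l ≋ (coeff p l + coeff q l)
  coeff-+ₚ []      q       l       = sym (+-identityˡ _)
  coeff-+ₚ (a ∷ p) []      l       = sym (+-identityʳ _)
  coeff-+ₚ (a ∷ p) (b ∷ q) zero    = refl
  coeff-+ₚ (a ∷ p) (b ∷ q) (suc l) = coeff-+ₚ p q l

  coeff-scale : ∀ a q l → coeff (map (a *_) q) l ≋ (a * coeff q l)
  coeff-scale a []      l       = sym (zeroʳ a)
  coeff-scale a (b ∷ q) zero    = refl
  coeff-scale a (b ∷ q) (suc l) = coeff-scale a q l

  coeff-∷-* : ∀ a p q l →
    coeff ((a ∷ p) *ₚ q) l ≋ (a * coeff q l + coeff (0# ∷ (p *ₚ q)) l)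
  coeff-∷-* a p q l = trans (coeff-+ₚ (map (a *_) q) (0# ∷ (p *ₚ q)) l)
                            (+-congʳ (coeff-scale a q l))

  coeff-sumₚ : ∀ {n} (f : Vector Poly n) l →
               coeff (sumₚ f) l ≋ sum (λ j → coeff (f j) l)
  coeff-sumₚ {zero}  f l = refl
  coeff-sumₚ {suc n} f l =
    trans (coeff-+ₚ (f zero) _ l) (+-congˡ (coeff-sumₚ (tail f) l))

  -- Coefficient lists may end in zeros, so degree bounds are conditions on coefficients and not on
  -- the lengths of lists.
  Null : Poly → Set ℓ
  Null p = ∀ l → coeff p l ≋ 0#

  Constant : Poly → Carrier → Set ℓ
  Constant p u = coeff p 0 ≋ u × (∀ l → coeff p (suc l) ≋ 0#)

  Linear : Poly → Carrier → Carrier → Set ℓ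
  Linear p u v =
    coeff p 0 ≋ u × coeff p 1 ≋ v × (∀ l → coeff p (suc (suc l)) ≋ 0#)

  null-∷ : ∀ {p} → Null p → Null (0# ∷ p)
  null-∷ null zero    = refl
  null-∷ null (suc l) = null l

  null-* : ∀ p q → Null p → Null (p *ₚ q)
  null-* []      q null l = refl
  null-* (a ∷ p) q null l = trans (coeff-∷-* a p q l)
    (0+0 (0*x (null 0)) (null-∷ (null-* p q (null ∘ suc)) l))

  coeff-constant-* : ∀ p q {u} → Constant p u →
                     ∀ l → coeff (p *ₚ q) l ≋ (u * coeff q l)
  coeff-constant-* []      q (p₀ , _)    l = sym (0*x (sym p₀))
  coeff-constant-* (a ∷ p) q (p₀ , null) l = begin
    coeff ((a ∷ p) *ₚ q) l                    ≈⟨ coeff-∷-* a p q l ⟩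
    a * coeff q l + coeff (0# ∷ (p *ₚ q)) l
      ≈⟨ x+0 (null-∷ (null-* p q null) l) ⟩
    a * coeff q l                             ≈⟨ *-congʳ p₀ ⟩
    _ * coeff q l                             ∎

  -- The list `0# ∷ q` represents X q, which spares a case distinction at degree 0.
  coeff-linear-* : ∀ p q {u v} → Linear p u v →
    ∀ l → coeff (p *ₚ q) l ≋ (u * coeff q l + v * coeff (0# ∷ q) l)
  coeff-linear-* [] q (p₀ , p₁ , _) l =
    sym (0+0 (0*x (sym p₀)) (0*x (sym p₁)))
  coeff-linear-* (a ∷ p) q {u} {v} (p₀ , p₁ , p₂) l = begin
    coeff ((a ∷ p) *ₚ q) l                   ≈⟨ coeff-∷-* a p q l ⟩
    a * coeff q l + coeff (0# ∷ (p *ₚ q)) l  ≈⟨ +-cong (*-congʳ p₀) (shift l) ⟩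
    u * coeff q l + v * coeff (0# ∷ q) l     ∎
    where
    shift : ∀ l → coeff (0# ∷ (p *ₚ q)) l ≋ (v * coeff (0# ∷ q) l)
    shift zero    = sym (zeroʳ v)
    shift (suc l) = coeff-constant-* p q (p₁ , p₂) l

  sign-constant : ∀ m → Constant ((-ₚ 1ₚ) ^ₚ m) ((- 1#) ^ m)
  sign-constant zero    = refl , λ _ → refl
  sign-constant (suc m) =
    let (s₀ , s₊) = sign-constant m
        scale     = coeff-constant-* (-ₚ 1ₚ) ((-ₚ 1ₚ) ^ₚ m) (refl , λ _ → refl)
    in trans (scale 0) (*-congˡ s₀) , λ l → trans (scale (suc l)) (x*0 (s₊ l))

  -- M is the matrix X D + A, up to the equality of coefficients.
  record Pencil {n} (M : PolyMatrix n) (D A : SquareMatrix n) : Set ℓ where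
    constructor mkPencil
    field
      linear : ∀ i j → Linear (M i j) (A i j) (D i j)

  open Pencil

  -- Determinants of pencils by Laplace expansion.

  minor-pencil : ∀ {n} {M : PolyMatrix (suc n)} {D A} → Pencil M D A →
                 ∀ j → Pencil (minor M j) (minor D j) (minor A j)
  minor-pencil pencil j = mkPencil λ r s → linear pencil (suc r) (punchIn j s)

  laplaceTerm : ∀ {n} → PolyMatrix (suc n) → (D A : SquareMatrix (suc n)) →
                ℕ → Fin (suc n) → Carrier
  laplaceTerm M D A l j = sign j *
    (A zero j * coeff (det (minor M j)) l +
     D zero j * coeff (0# ∷ det (minor M j)) l)

  coeff-det : ∀ {n} {M : PolyMatrix (suc n)} {D A} → Pencil M D A → ∀ l →
              coeff (det M) l ≋ sum (laplaceTerm M D A l)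
  coeff-det {n} {M} pencil l =
    trans (coeff-sumₚ {suc n} (λ j → (-ₚ 1ₚ) ^ₚ toℕ j *ₚ cofactor j) l)
          (sum-cong-≋ {suc n} λ j → trans
            (coeff-constant-* ((-ₚ 1ₚ) ^ₚ toℕ j) (cofactor j)
              (sign-constant (toℕ j)) l)
            (*-congˡ (coeff-linear-* (M zero j) (det (minor M j))
              (linear pencil zero j) l)))
    where
    cofactor : Fin (suc n) → Poly
    cofactor j = M zero j *ₚ det (minor M j)

  coeff-det-above : ∀ {n} {M : PolyMatrix n} {D A} → Pencil M D A →
                    ∀ l → n ℕ.< l → coeff (det M) l ≋ 0#
  coeff-det-above {zero}  pencil (suc l) n<l       = refl
  coeff-det-above {suc n} {M} {D} {A} pencil (suc l) (s≤s n<l) =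
    trans (coeff-det pencil (suc l))
          (sum-zero (laplaceTerm M D A (suc l)) λ j → x*0 (0+0
      (x*0 (coeff-det-above (minor-pencil pencil j) (suc l) (ℕₚ.m<n⇒m<1+n n<l)))
      (x*0 (coeff-det-above (minor-pencil pencil j) l n<l))))

  -- The minor of column 0 has degree at most `n`, and the entry in front of it is free of `X`.
  -- Every other minor keeps column 0 in place, so that the induction applies to it.
  coeff-det-zeroColumn : ∀ {n} {M : PolyMatrix (suc n)} {D A} → Pencil M D A →
    (∀ r → D r zero ≋ 0#) → ∀ l → n ℕ.< l → coeff (det M) l ≋ 0#
  coeff-det-zeroColumn {n} {M} {D} {A} pencil D₀≋0 (suc l) (s≤s n≤l) =
    trans (coeff-det pencil (suc l))
          (sum-zero (laplaceTerm M D A (suc l)) vanish)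
    where
    vanish : ∀ j → laplaceTerm M D A (suc l) j ≋ 0#
    vanish zero = x*0 (0+0
      (x*0 (coeff-det-above (minor-pencil pencil zero) (suc l) (s≤s n≤l)))
      (0*x (D₀≋0 zero)))
    vanish (suc {n = suc _} j) = x*0 (0+0
      (x*0 (coeff-det-zeroColumn (minor-pencil pencil (suc j)) (D₀≋0 ∘ suc)
             (suc l) (ℕₚ.m≤n⇒m≤1+n n≤l)))
      (x*0 (coeff-det-zeroColumn (minor-pencil pencil (suc j)) (D₀≋0 ∘ suc)
             l n≤l)))

  -- Each expansion moves row `i` up by one place until it is row 0, where its entries are free of
  -- `X` and cannot raise the degree of the minors.
  coeff-det-zeroRow : ∀ {n} {M : PolyMatrix n} {D A} → Pencil M D A →
    (i : Fin n) → (∀ s → D i s ≋ 0#) → ∀ l → n ℕ.≤ l → coeff (det M) l ≋ 0#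
  coeff-det-zeroRow {M = M} {D} {A} pencil zero Dᵢ≋0 (suc l) (s≤s n≤l) =
    trans (coeff-det pencil (suc l))
          (sum-zero (laplaceTerm M D A (suc l)) λ j → x*0 (0+0
      (x*0 (coeff-det-above (minor-pencil pencil j) (suc l) (s≤s n≤l)))
      (0*x (Dᵢ≋0 j))))
  coeff-det-zeroRow {M = M} {D} {A} pencil (suc i) Dᵢ≋0 (suc l) (s≤s n≤l) =
    trans (coeff-det pencil (suc l))
          (sum-zero (laplaceTerm M D A (suc l)) λ j → x*0 (0+0
      (x*0 (coeff-det-zeroRow (minor-pencil pencil j) i (Dᵢ≋0 ∘ punchIn j)
             (suc l) (ℕₚ.m≤n⇒m≤1+n n≤l)))
      (x*0 (coeff-det-zeroRow (minor-pencil pencil j) i (Dᵢ≋0 ∘ punchIn j)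
             l n≤l))))

  -- In row 0 only the diagonal entry contains `X`, and minors of size `n` have nothing in degree n
  -- + 1, so a single term of the expansion survives.
  coeff-det-monic : ∀ {n} {M : PolyMatrix n} {D A} → Pencil M D A →
    (∀ i j → D i j ≋ 𝟙 i j) → coeff (det M) n ≋ 1#
  coeff-det-monic {zero}  pencil D≋𝟙 = refl
  coeff-det-monic {suc n} {M} {D} {A} pencil D≋𝟙 = begin
    coeff (det M) (suc n)  ≈⟨ coeff-det pencil (suc n) ⟩
    sum term               ≈⟨ x+0 (sum-zero (tail term) λ j → x*0 (0+0
                                (A*above (suc j)) (0*x (D≋𝟙 zero (suc j))))) ⟩
    term zero              ≈⟨ *-identityˡ _ ⟩
    _ + _                  ≈⟨ 0+x (A*above zero) ⟩
    _ * _                  ≈⟨ 1*x (D≋𝟙 zero zero) ⟩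
    coeff (det (minor M zero)) n
      ≈⟨ coeff-det-monic (minor-pencil pencil zero)
           (λ i j → D≋𝟙 (suc i) (suc j)) ⟩
    1#                     ∎
    where
    term : Vector Carrier (suc n)
    term = laplaceTerm M D A (suc n)
    A*above : ∀ j → (A zero j * coeff (det (minor M j)) (suc n)) ≋ 0#
    A*above j =
      x*0 (coeff-det-above (minor-pencil pencil j) (suc n) ℕₚ.≤-refl)

  -- D is the identity matrix without row 0 and column j + 1, so that in degree m
  -- only the row j, free of X, contributes its entry in column 0.
  coeff-det-cofactor : ∀ {m} {M : PolyMatrix (suc m)} {D A} → Pencil M D A →
    (j : Fin (suc m)) → (∀ r s → D r s ≋ 𝟙 (suc r) (punchIn (suc j) s)) →
    coeff (det M) m ≋ (sign j * A j zero)
  coeff-det-cofactor {m} {M} {D} {A} pencil zero D≋ = begin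
    coeff (det M) m        ≈⟨ coeff-det pencil m ⟩
    sum term               ≈⟨ x+0 (sum-zero (tail term) (rest pencil D≋)) ⟩
    term zero              ≈⟨ *-congˡ (x+0 (0*x (D≋ zero zero))) ⟩
    _ * (A zero zero * _)
      ≈⟨ *-congˡ (*-congˡ (coeff-det-monic (minor-pencil pencil zero)
           (λ r s → D≋ (suc r) (suc s)))) ⟩
    _ * (A zero zero * 1#) ≈⟨ *-congˡ (*-identityʳ _) ⟩
    _ * A zero zero        ∎
    where
    term : Vector Carrier (suc m)
    term = laplaceTerm M D A m
    rest : ∀ {m} {M : PolyMatrix (suc m)} {D A} → Pencil M D A →
           (∀ r s → D r s ≋ 𝟙 (suc r) (punchIn (suc zero) s)) →
           ∀ s → laplaceTerm M D A m (suc s) ≋ 0#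
    -- Column 0 of `D` is zero and stays in this minor, which lowers the degree of the minor to at
    -- most `m`.
    rest {suc m} pencil D≋ s = x*0 (0+0
      (x*0 (coeff-det-zeroColumn (minor-pencil pencil (suc s))
             (λ r → D≋ (suc r) zero) (suc m) ℕₚ.≤-refl))
      (0*x (D≋ zero (suc s))))
  coeff-det-cofactor {suc m} {M} {D} {A} pencil (suc j) D≋ = begin
    coeff (det M) (suc m)             ≈⟨ coeff-det pencil (suc m) ⟩
    sum term                          ≈⟨ 0+x first ⟩
    sum (tail term)
      ≈⟨ x+0 (sum-zero (tail (tail term)) λ s →
           x*0 (0+0 (A*minor (suc s)) (0*x (D≋ zero (suc (suc s)))))) ⟩
    term (suc zero)
      ≈⟨ *-cong (*-identityʳ _) (0+x (A*minor zero)) ⟩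
    - 1# * (D zero (suc zero) * coeff (det (minor M (suc zero))) m)
      ≈⟨ *-congˡ (1*x (D≋ zero (suc zero))) ⟩
    - 1# * coeff (det (minor M (suc zero))) m
      ≈⟨ *-congˡ
           (coeff-det-cofactor (minor-pencil pencil (suc zero)) j minor-D≋) ⟩
    - 1# * (sign j * A (suc j) zero)  ≈⟨ *-assoc _ _ _ ⟨
    - 1# * sign j * A (suc j) zero    ∎
    where
    term : Vector Carrier (suc (suc m))
    term = laplaceTerm M D A (suc m)
    -- Row `suc j` of `D` is zero, because the column that held its 1 is missing; it is row `j` of
    -- this minor.
    first : term zero ≋ 0#
    first = x*0 (0+0
      (x*0 (coeff-det-zeroRow (minor-pencil pencil zero) j
        (λ s → trans (D≋ (suc j) (suc s))
                     (𝟙-≢ (punchInᵢ≢i (suc j) s ∘ ≡.sym)))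
        (suc m) ℕₚ.≤-refl))
      (0*x (D≋ zero zero)))
    A*minor : ∀ s → (A zero (suc s) * coeff (det (minor M (suc s))) (suc m)) ≋ 0#
    A*minor s = x*0 (coeff-det-zeroColumn (minor-pencil pencil (suc s))
      (λ r → D≋ (suc r) zero) (suc m) ℕₚ.≤-refl)
    -- Without row 0 and column 1 the same shape remains, with `j` in place of `suc j`.
    minor-D≋ : ∀ r s → minor D (suc zero) r s ≋ 𝟙 (suc r) (punchIn (suc j) s)
    minor-D≋ r zero    = D≋ (suc r) zero
    minor-D≋ r (suc s) = D≋ (suc r) (suc (suc s))

  -- The sum of the principal 2 × 2 minors of a matrix with zero diagonal.
  hollowMinors₂ : ∀ {n} → SquareMatrix n → Carrier
  hollowMinors₂ {zero}  A = 0#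
  hollowMinors₂ {suc n} A =
    sum (λ j → - (A zero (suc j) * A (suc j) zero)) +
      hollowMinors₂ (minor A zero)

  -- Prefixing two zeros to a polynomial makes its coefficient of degree n - 2 the
  -- one of index n, and 0 if n < 2.
  coeff-det-hollow : ∀ {n} {M : PolyMatrix n} {D A} → Pencil M D A →
    (∀ i j → D i j ≋ 𝟙 i j) → (∀ i → A i i ≋ 0#) →
    coeff (0# ∷ 0# ∷ det M) n ≋ hollowMinors₂ A
  coeff-det-hollow {zero}        pencil D≋𝟙 hollow = refl
  coeff-det-hollow {suc zero}    pencil D≋𝟙 hollow = sym (+-identityˡ 0#)
  coeff-det-hollow {suc (suc m)} {M} {D} {A} pencil D≋𝟙 hollow = begin
    coeff (det M) m             ≈⟨ coeff-det pencil m ⟩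
    term zero + sum (tail term)
      ≈⟨ +-cong first (sum-cong-≋ {suc m} other) ⟩
    coeff (0# ∷ det (minor M zero)) m +
      sum (λ j → - (A zero (suc j) * A (suc j) zero))
      ≈⟨ +-comm _ _ ⟩
    sum (λ j → - (A zero (suc j) * A (suc j) zero)) +
      coeff (0# ∷ det (minor M zero)) m
      ≈⟨ +-congˡ (coeff-det-hollow (minor-pencil pencil zero)
           (λ i j → D≋𝟙 (suc i) (suc j)) (hollow ∘ suc)) ⟩
    hollowMinors₂ A             ∎
    where
    term : Vector Carrier (suc (suc m))
    term = laplaceTerm M D A m
    -- With zero diagonal the entry at (0, 0) is just `X`, which shifts the degree of the minor by
    -- one.
    first : term zero ≋ coeff (0# ∷ det (minor M zero)) m
    first = begin
      term zero                          ≈⟨ *-identityˡ _ ⟩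
      _ + _                              ≈⟨ 0+x (0*x (hollow zero)) ⟩
      _ * _                              ≈⟨ 1*x (D≋𝟙 zero zero) ⟩
      coeff (0# ∷ det (minor M zero)) m  ∎
    -- The sign (-1)^(j+1) of the expansion and the sign (-1)^j from `coeff-det-cofactor` combine to
    -- -1.
    other : ∀ j → term (suc j) ≋ (- (A zero (suc j) * A (suc j) zero))
    other j = begin
      term (suc j)
        ≈⟨ *-congˡ (x+0 (0*x (D≋𝟙 zero (suc j)))) ⟩
      - 1# * sign j * (A zero (suc j) * coeff (det (minor M (suc j))) m)
        ≈⟨ *-congˡ (*-congˡ (coeff-det-cofactor (minor-pencil pencil (suc j)) j
             (λ r s → D≋𝟙 (suc r) (punchIn (suc j) s)))) ⟩
      - 1# * sign j * (A zero (suc j) * (sign j * A (suc j) zero))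
        ≈⟨ *-assoc _ _ _ ⟩
      - 1# * (sign j * (A zero (suc j) * (sign j * A (suc j) zero)))
        ≈⟨ -1*x≈-x _ ⟩
      - (sign j * (A zero (suc j) * (sign j * A (suc j) zero)))
        ≈⟨ -‿cong (*-assoc _ _ _) ⟨
      - ((sign j * A zero (suc j)) * (sign j * A (suc j) zero))
        ≈⟨ -‿cong (interchange _ _ _ _) ⟩
      - ((sign j * sign j) * (A zero (suc j) * A (suc j) zero))
        ≈⟨ -‿cong (1*x (sign² (toℕ j))) ⟩
      - (A zero (suc j) * A (suc j) zero)  ∎

  coeff-charpoly-hollow : ∀ {n} (A : SquareMatrix n) → (∀ i → A i i ≋ 0#) →
    coeff (0# ∷ 0# ∷ charpoly A) n ≋ hollowMinors₂ (λ i j → - A i j)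
  coeff-charpoly-hollow A hollow = coeff-det-hollow
    (mkPencil entry) (λ _ _ → refl)
    (λ i → trans (-‿cong (hollow i)) -0#≈0#)
    where
    entry : ∀ i j → Linear ((if does (i ≟ j) then X else []) +ₚ (-ₚ C (A i j)))
                           (- A i j) (𝟙 i j)
    entry i j with i ≟ j
    ... | yes _ = +-identityˡ _ , refl , λ _ → refl
    ... | no  _ = refl , refl , λ _ → refl

  -- Top coefficients of a product of linear factors.

  e₂ : ∀ {n} → Vector Carrier n → Carrier
  e₂ {zero}  ρ = 0#
  e₂ {suc n} ρ = ρ zero * sum (tail ρ) + e₂ (tail ρ)

  ∏ : ∀ {n} → Vector Carrier n → Poly
  ∏ ρ = productₚ (λ i → X +ₚ (-ₚ C (ρ i)))

  coeff-∏ : ∀ {n} (ρ : Vector Carrier (suc n)) l →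
    coeff (∏ ρ) l ≋
      (- ρ zero * coeff (∏ (tail ρ)) l + coeff (0# ∷ ∏ (tail ρ)) l)
  coeff-∏ ρ l = trans
    (coeff-linear-* (X +ₚ (-ₚ C (ρ zero))) (∏ (tail ρ))
      (+-identityˡ _ , refl , λ _ → refl) l)
    (+-congˡ (*-identityˡ _))

  coeff-∏-above : ∀ {n} (ρ : Vector Carrier n) l → n ℕ.< l →
                  coeff (∏ ρ) l ≋ 0#
  coeff-∏-above {zero}  ρ (suc l) n<l       = refl
  coeff-∏-above {suc n} ρ (suc l) (s≤s n<l) = trans (coeff-∏ ρ (suc l))
    (0+0 (x*0 (coeff-∏-above (tail ρ) (suc l) (ℕₚ.m<n⇒m<1+n n<l)))
         (coeff-∏-above (tail ρ) l n<l))

  coeff-∏-monic : ∀ {n} (ρ : Vector Carrier n) → coeff (∏ ρ) n ≋ 1#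
  coeff-∏-monic {zero}  ρ = refl
  coeff-∏-monic {suc n} ρ = trans (coeff-∏ ρ (suc n)) (trans
    (0+x (x*0 (coeff-∏-above (tail ρ) (suc n) ℕₚ.≤-refl)))
    (coeff-∏-monic (tail ρ)))

  -- Vieta's formula in degree n - 1; the prefixed zero gives 0 when n = 0.
  coeff-∏-sum : ∀ {n} (ρ : Vector Carrier n) →
                coeff (0# ∷ ∏ ρ) n ≋ (- sum ρ)
  coeff-∏-sum {zero}  ρ = sym -0#≈0#
  coeff-∏-sum {suc n} ρ = begin
    coeff (∏ ρ) n                       ≈⟨ coeff-∏ ρ n ⟩
    - ρ zero * coeff (∏ (tail ρ)) n + coeff (0# ∷ ∏ (tail ρ)) n
      ≈⟨ +-cong (*-congˡ (coeff-∏-monic (tail ρ))) (coeff-∏-sum (tail ρ)) ⟩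
    - ρ zero * 1# + - sum (tail ρ)      ≈⟨ +-congʳ (*-identityʳ _) ⟩
    - ρ zero + - sum (tail ρ)           ≈⟨ -‿+-comm _ _ ⟩
    - (ρ zero + sum (tail ρ))           ∎

  -- Vieta's formula in degree n - 2: the factor - ρ₀ meets the coefficient - `sum (tail ρ)`, and
  -- the signs cancel.
  coeff-∏-e₂ : ∀ {n} (ρ : Vector Carrier n) →
    coeff (0# ∷ 0# ∷ ∏ ρ) n ≋ e₂ ρ
  coeff-∏-e₂ {zero}        ρ = refl
  coeff-∏-e₂ {suc zero}    ρ = sym (0+0 (zeroʳ _) refl)
  coeff-∏-e₂ {suc (suc m)} ρ = begin
    coeff (∏ ρ) m  ≈⟨ coeff-∏ ρ m ⟩
    - ρ zero * coeff (∏ (tail ρ)) m + coeff (0# ∷ ∏ (tail ρ)) m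
      ≈⟨ +-cong (*-congˡ (coeff-∏-sum (tail ρ))) (coeff-∏-e₂ (tail ρ)) ⟩
    - ρ zero * - sum (tail ρ) + e₂ (tail ρ)
      ≈⟨ +-congʳ (-x*-y _ _) ⟩
    e₂ ρ           ∎

open ≡ using (refl; sym; trans; cong; cong₂; subst; subst₂; module ≡-Reasoning)

private
  variable
    n k : ℕ

  2ℚ 4ℚ : ℚ
  2ℚ = + 2 ℚ./ 1
  4ℚ = + 4 ℚ./ 1

-- Rational inequalities

0≤q-p : ∀ {p q} → p ℚ.≤ q → 0ℚ ℚ.≤ q ℚ.- p
0≤q-p {p} {q} p≤q =
  subst (ℚ._≤ q ℚ.- p) (ℚₚ.+-inverseʳ p) (ℚₚ.+-monoˡ-≤ (ℚ.- p) p≤q)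

-- Splits an inequality into the sign of an explicit difference `d` and a ring identity for the
-- solver.
≤-from-slack : ∀ {p q} d → 0ℚ ℚ.≤ d → p ℚ.+ d ≡ q → p ℚ.≤ q
≤-from-slack {p} {q} d 0≤d p+d≡q =
  subst₂ ℚ._≤_ (ℚₚ.+-identityʳ p) p+d≡q (ℚₚ.+-monoʳ-≤ p 0≤d)

<-from-slack : ∀ {p q} d → 0ℚ ℚ.< d → p ℚ.+ d ≡ q → p ℚ.< q
<-from-slack {p} {q} d 0<d p+d≡q =
  subst₂ ℚ._<_ (ℚₚ.+-identityʳ p) p+d≡q (ℚₚ.+-monoʳ-< p 0<d)

0<q-p : ∀ {p q} → p ℚ.< q → 0ℚ ℚ.< q ℚ.- p
0<q-p {p} {q} p<q =
  subst (ℚ._< q ℚ.- p) (ℚₚ.+-inverseʳ p) (ℚₚ.+-monoˡ-< (ℚ.- p) p<q)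

0≤+ : ∀ {p q} → 0ℚ ℚ.≤ p → 0ℚ ℚ.≤ q → 0ℚ ℚ.≤ p ℚ.+ q
0≤+ = ℚₚ.+-mono-≤

0≤* : ∀ {p q} → 0ℚ ℚ.≤ p → 0ℚ ℚ.≤ q → 0ℚ ℚ.≤ p ℚ.* q
0≤* {p} {q} 0≤p 0≤q = ℚₚ.nonNegative⁻¹ (p ℚ.* q)
  {{ℚₚ.nonNeg*nonNeg⇒nonNeg p {{ℚ.nonNegative 0≤p}} q {{ℚ.nonNegative 0≤q}}}}

0<* : ∀ {p q} → 0ℚ ℚ.< p → 0ℚ ℚ.< q → 0ℚ ℚ.< p ℚ.* q
0<* {p} {q} 0<p 0<q = subst (ℚ._< p ℚ.* q) (ℚₚ.*-zeroʳ p)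
  (ℚₚ.*-monoʳ-<-pos p {{ℚ.positive 0<p}} 0<q)

∣p∣²≡p² : ∀ p → ℚ.∣ p ∣ ℚ.* ℚ.∣ p ∣ ≡ p ℚ.* p
∣p∣²≡p² p with ℚₚ.∣p∣≡p∨∣p∣≡-p p
... | inj₁ eq = cong₂ ℚ._*_ eq eq
... | inj₂ eq = trans (cong₂ ℚ._*_ eq eq)
                      (solve 1 (λ p → (:- p) :* (:- p) := p :* p) refl p)
  where open +-*-Solver

0≤p² : ∀ p → 0ℚ ℚ.≤ p ℚ.* p
0≤p² p = subst (0ℚ ℚ.≤_) (∣p∣²≡p² p) (0≤* (ℚₚ.0≤∣p∣ p) (ℚₚ.0≤∣p∣ p))

-p≤∣p∣ : ∀ p → ℚ.- p ℚ.≤ ℚ.∣ p ∣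
-p≤∣p∣ p with ℚₚ.∣p∣≡p∨∣p∣≡-p p
... | inj₂ eq = ℚₚ.≤-reflexive (sym eq)
... | inj₁ eq = ℚₚ.≤-trans (ℚₚ.neg-antimono-≤ 0≤p) 0≤∣p∣
  where
  0≤∣p∣ = ℚₚ.0≤∣p∣ p
  0≤p   = subst (0ℚ ℚ.≤_) eq 0≤∣p∣

-- By contraposition: if q ≤ p, then p² - q² = (p - q)² + 2 q (p - q) is nonnegative.
square-cancel-< : ∀ {p q} → 0ℚ ℚ.≤ q → p ℚ.* p ℚ.< q ℚ.* q → p ℚ.< q
square-cancel-< {p} {q} 0≤q p²<q² = ℚₚ.≰⇒> λ q≤p →
  ℚₚ.<-irrefl refl (ℚₚ.<-≤-trans p²<q²
    (≤-from-slack ((p ℚ.- q) ℚ.* (p ℚ.- q) ℚ.+ 2ℚ ℚ.* (q ℚ.* (p ℚ.- q)))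
      (0≤+ (0≤p² (p ℚ.- q)) (0≤* (ℚₚ.nonNegative⁻¹ 2ℚ) (0≤* 0≤q (0≤q-p q≤p))))
      (solve 2 (λ p q → q :* q :+ ((p :- q) :* (p :- q) :+
          con 2ℚ :* (q :* (p :- q))) := p :* p) refl p q)))
  where open +-*-Solver

-- The embedding of the integers

-- Division normalises by a gcd that is stuck on a variable `z`; the explicit fraction lets the
-- rational operations unfold.
z/1≡mkℚ : ∀ z → z ℚ./ 1 ≡
          mkℚ z 0 (Coprimality.sym (Coprimality.1-coprimeTo ℤ.∣ z ∣))
z/1≡mkℚ z = ℚₚ.↥p/↧p≡p (mkℚ z 0 _)

/1-homo-+ : ∀ y z → (y ℤ.+ z) ℚ./ 1 ≡ y ℚ./ 1 ℚ.+ z ℚ./ 1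
/1-homo-+ y z rewrite z/1≡mkℚ y | z/1≡mkℚ z =
  cong (ℚ._/ 1) (sym (cong₂ ℤ._+_ (ℤₚ.*-identityʳ y) (ℤₚ.*-identityʳ z)))

/1-homo-* : ∀ y z → (y ℤ.* z) ℚ./ 1 ≡ y ℚ./ 1 ℚ.* (z ℚ./ 1)
/1-homo-* y z rewrite z/1≡mkℚ y | z/1≡mkℚ z = refl

/1-mono-≤ : ∀ {y z} → y ℤ.≤ z → y ℚ./ 1 ℚ.≤ z ℚ./ 1
/1-mono-≤ {y} {z} y≤z rewrite z/1≡mkℚ y | z/1≡mkℚ z =
  ℚ.*≤* (ℤₚ.*-monoʳ-≤-nonNeg (+ 1) y≤z)

suc/1 : ∀ m → + suc m ℚ./ 1 ≡ 1ℚ ℚ.+ + m ℚ./ 1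
suc/1 m = /1-homo-+ (+ 1) (+ m)

-- Reals compared index by index

infix 4 _≗ᴿ_

_≗ᴿ_ : ℝ → ℝ → Set
x ≗ᴿ y = ∀ i → seq x i ≡ seq y i

-- Under this equality `seq` embeds the reals into the rational sequences with pointwise operations,
-- and the ring laws are pulled back along it.
≗ᴿ-isCommutativeRing : IsCommutativeRing _≗ᴿ_ _+ᴿ_ _*ᴿ_ -ᴿ_ 0ᴿ 1ᴿ
≗ᴿ-isCommutativeRing = RingMonomorphism.isCommutativeRing
  {R₁ = record { Carrier = ℝ ; _≈_ = _≗ᴿ_ ; _+_ = _+ᴿ_ ; _*_ = _*ᴿ_ ; -_ = -ᴿ_
               ; 0# = 0ᴿ ; 1# = 1ᴿ }}
  {R₂ = record { Carrier = ℕ → ℚ ; _≈_ = λ x y → ∀ i → x i ≡ y i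
               ; _+_ = λ x y i → x i ℚ.+ y i ; _*_ = λ x y i → x i ℚ.* y i
               ; -_ = λ x i → ℚ.- x i ; 0# = λ _ → 0ℚ ; 1# = λ _ → 1ℚ }}
  {seq}
  record
    { isRingHomomorphism = record
      { isSemiringHomomorphism = record
        { isNearSemiringHomomorphism = record
          { +-isMonoidHomomorphism = record
            { isMagmaHomomorphism = record
              { isRelHomomorphism = record { cong = λ x≗y → x≗y }
              ; homo = λ _ _ _ → refl
              }
            ; ε-homo = λ _ → refl
            }
          ; *-homo = λ _ _ _ → refl
          }
        ; 1#-homo = λ _ → refl
        }
      ; -‿homo = λ _ _ → refl
      }
    ; injective = λ x≗y → x≗y
    }
  (Pointwise.isCommutativeRing ℕ ℚₚ.+-*-isCommutativeRing)

open TopCoefficients ℝ-rawRing _≗ᴿ_ ≗ᴿ-isCommutativeRing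
  using (minor; hollowMinors₂; coeff-charpoly-hollow; e₂; coeff-∏-e₂)
open RawSemiringDefinitions (RawRing.rawSemiring ℝ-rawRing) using ()
  renaming (sum to ∑)
open Matrix ℝ-rawRing using (SquareMatrix)
open CharacteristicPolynomial ℝ-rawRing using (Eigenvalues)

-- The absolute values against the elementary symmetric polynomials

∣∑∣≤∑∣∣ : ∀ (ρ : Vector ℝ n) i →
          ℚ.∣ seq (∑ ρ) i ∣ ℚ.≤ seq (∑ (λ j → ∣ ρ j ∣ᴿ)) i
∣∑∣≤∑∣∣ {zero}  ρ i = ℚₚ.≤-refl
∣∑∣≤∑∣∣ {suc n} ρ i = ℚₚ.≤-trans (ℚₚ.∣p+q∣≤∣p∣+∣q∣ (seq (ρ zero) i) _)
  (ℚₚ.+-monoʳ-≤ ℚ.∣ seq (ρ zero) i ∣ (∣∑∣≤∑∣∣ (tail ρ) i))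

-- The right side exceeds the left by twice the sum of |ρᵢ ρⱼ| + ρᵢ ρⱼ over i < j, and each summand
-- is nonnegative.
[∑]²≤[∑∣∣]²+4e₂ : ∀ (ρ : Vector ℝ n) i →
  seq (∑ ρ) i ℚ.* seq (∑ ρ) i ℚ.≤
    seq (∑ (λ j → ∣ ρ j ∣ᴿ)) i ℚ.* seq (∑ (λ j → ∣ ρ j ∣ᴿ)) i
      ℚ.+ 4ℚ ℚ.* seq (e₂ ρ) i
[∑]²≤[∑∣∣]²+4e₂ {zero}  ρ i = ℚₚ.≤-refl
[∑]²≤[∑∣∣]²+4e₂ {suc n} ρ i = step
  (seq (ρ zero) i) (seq (∑ (tail ρ)) i) (seq (∑ (λ j → ∣ tail ρ j ∣ᴿ)) i)
  (seq (e₂ (tail ρ)) i) ([∑]²≤[∑∣∣]²+4e₂ (tail ρ) i) (∣∑∣≤∑∣∣ (tail ρ) i)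
  where
  step : ∀ x t s e → t ℚ.* t ℚ.≤ s ℚ.* s ℚ.+ 4ℚ ℚ.* e → ℚ.∣ t ∣ ℚ.≤ s →
    (x ℚ.+ t) ℚ.* (x ℚ.+ t) ℚ.≤
      (ℚ.∣ x ∣ ℚ.+ s) ℚ.* (ℚ.∣ x ∣ ℚ.+ s) ℚ.+ 4ℚ ℚ.* (x ℚ.* t ℚ.+ e)
  -- The slack is that of the induction hypothesis, plus |x|² - x², which is 0, plus 2 (|x| s + x
  -- t), nonnegative since |t| ≤ s.
  step x t s e t²≤ ∣t∣≤s = ≤-from-slack
    (((s ℚ.* s ℚ.+ 4ℚ ℚ.* e) ℚ.- t ℚ.* t) ℚ.+
      ((a ℚ.* a ℚ.- x ℚ.* x) ℚ.+ 2ℚ ℚ.* (a ℚ.* s ℚ.- ℚ.- (x ℚ.* t))))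
    (0≤+ (0≤q-p t²≤) (0≤+ (0≤q-p (ℚₚ.≤-reflexive (sym (∣p∣²≡p² x))))
      (0≤* (ℚₚ.nonNegative⁻¹ 2ℚ) (0≤q-p -xt≤as))))
    (solve 5 (λ x t s e a →
      (x :+ t) :* (x :+ t) :+ (((s :* s :+ con 4ℚ :* e) :- t :* t) :+
        ((a :* a :- x :* x) :+ con 2ℚ :* (a :* s :- :- (x :* t))))
      := (a :+ s) :* (a :+ s) :+ con 4ℚ :* (x :* t :+ e)) refl x t s e a)
    where
    open +-*-Solver
    a = ℚ.∣ x ∣
    -xt≤as : ℚ.- (x ℚ.* t) ℚ.≤ a ℚ.* s
    -xt≤as = begin
      ℚ.- (x ℚ.* t)      ≤⟨ -p≤∣p∣ (x ℚ.* t) ⟩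
      ℚ.∣ x ℚ.* t ∣      ≡⟨ ℚₚ.∣p*q∣≡∣p∣*∣q∣ x t ⟩
      a ℚ.* ℚ.∣ t ∣      ≤⟨ ℚₚ.*-monoˡ-≤-nonNeg a {{ℚₚ.∣-∣-nonNeg x}} ∣t∣≤s ⟩
      a ℚ.* s            ∎
      where open ℚₚ.≤-Reasoning

0≤∑∣∣ : ∀ (ρ : Vector ℝ n) i → 0ℚ ℚ.≤ seq (∑ (λ j → ∣ ρ j ∣ᴿ)) i
0≤∑∣∣ ρ i = ℚₚ.≤-trans (ℚₚ.0≤∣p∣ (seq (∑ ρ) i)) (∣∑∣≤∑∣∣ ρ i)

-- Matrices with zero diagonal and large off-diagonal entries

∑-neg-≤ : ∀ (x : Vector ℝ n) i → (∀ j → 1ℚ ℚ.≤ seq (x j) i) →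
      seq (∑ (λ j → -ᴿ x j)) i ℚ.≤ ℚ.- (+ n ℚ./ 1)
∑-neg-≤ {zero}  x i 1≤x = ℚₚ.≤-refl
∑-neg-≤ {suc n} x i 1≤x = subst (seq (∑ (λ j → -ᴿ x j)) i ℚ.≤_)
  (trans (sym (ℚₚ.neg-distrib-+ 1ℚ (+ n ℚ./ 1))) (cong ℚ.-_ (sym (suc/1 n))))
  (ℚₚ.+-mono-≤ (ℚₚ.neg-antimono-≤ (1≤x zero)) (∑-neg-≤ (tail x) i (1≤x ∘ suc)))

-- A division-free form of - h ≥ n (n - 1) / 2 for the sum h of minors. Going from size `n` to
-- `suc n` adds `n` products to - h, each at least 1.
hollowMinors₂-≤ : ∀ (A : SquareMatrix n) i →
  (∀ r s → r ≢ s → 1ℚ ℚ.≤ seq (A r s) i ℚ.* seq (A s r) i) →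
  (+ n ℚ./ 1) ℚ.* (+ n ℚ./ 1) ℚ.+ 2ℚ ℚ.* seq (hollowMinors₂ A) i ℚ.≤ + n ℚ./ 1
hollowMinors₂-≤ {zero}  A i 1≤ = ℚₚ.≤-refl
hollowMinors₂-≤ {suc n} A i 1≤ =
  subst (λ v → v ℚ.* v ℚ.+ 2ℚ ℚ.* seq (hollowMinors₂ A) i ℚ.≤ v) (sym (suc/1 n))
    (step (+ n ℚ./ 1) _ _
      (hollowMinors₂-≤ (minor A zero) i
        (λ r s r≢s → 1≤ (suc r) (suc s) (r≢s ∘ suc-injective)))
      (∑-neg-≤ (λ j → A zero (suc j) *ᴿ A (suc j) zero) i
        (λ j → 1≤ zero (suc j) λ ())))
  where
  step : ∀ v t h → v ℚ.* v ℚ.+ 2ℚ ℚ.* h ℚ.≤ v → t ℚ.≤ ℚ.- v →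
    (1ℚ ℚ.+ v) ℚ.* (1ℚ ℚ.+ v) ℚ.+ 2ℚ ℚ.* (t ℚ.+ h) ℚ.≤ 1ℚ ℚ.+ v
  step v t h p q = ≤-from-slack
    ((v ℚ.- (v ℚ.* v ℚ.+ 2ℚ ℚ.* h)) ℚ.+ 2ℚ ℚ.* (ℚ.- v ℚ.- t))
    (0≤+ (0≤q-p p) (0≤* (ℚₚ.nonNegative⁻¹ 2ℚ) (0≤q-p q)))
    (solve 3 (λ v t h →
      ((con 1ℚ :+ v) :* (con 1ℚ :+ v) :+ con 2ℚ :* (t :+ h)) :+
        ((v :- (v :* v :+ con 2ℚ :* h)) :+ con 2ℚ :* (:- v :- t))
      := con 1ℚ :+ v) refl v t h)
    where open +-*-Solver

-- Entries of the Seidel matrix.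

z≢0⇒1≤z² : ∀ z → z ≢ +0 → + 1 ℤ.≤ z ℤ.* z
z≢0⇒1≤z² +0       z≢0 = contradiction refl z≢0
z≢0⇒1≤z² +[1+ m ] z≢0 = ℤ.+≤+ (s≤s z≤n)
z≢0⇒1≤z² -[1+ m ] z≢0 = ℤ.+≤+ (s≤s z≤n)

1-2c≢0 : ∀ c → ℤ.1ℤ ℤ.- + (2 ℕ.* c) ≢ +0
1-2c≢0 c eq = odd c (ℤₚ.+-injective (ℤₚ.i-j≡0⇒i≡j ℤ.1ℤ (+ (2 ℕ.* c)) eq))
  where
  odd : ∀ c → 1 ≢ 2 ℕ.* c
  odd zero    ()
  odd (suc c) eq with () ← trans (ℕₚ.suc-injective eq) (ℕₚ.+-suc c (c ℕ.+ 0))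

codegree-sym : ∀ (H : Hypergraph n k) r s →
               codegree {n} {k} H r s ≡ codegree {n} {k} H s r
codegree-sym {n} {k} H r s = cong length
  (filter-≐ (λ e → (r ∈? e) ×-dec (s ∈? e)) (λ e → (s ∈? e) ×-dec (r ∈? e))
    (swap , swap) (edges {n} {k} H))

seidel-hollow : ∀ (H : Hypergraph n k) r → seidel {n} {k} H r r ≗ᴿ 0ᴿ
seidel-hollow H r i rewrite dec-true (r ≟ r) refl = refl

seidel-off : ∀ (H : Hypergraph n k) r s → r ≢ s → ∀ i →
  seq (seidel {n} {k} H r s) i ≡
    (ℤ.1ℤ ℤ.- + (2 ℕ.* codegree {n} {k} H r s)) ℚ./ 1
seidel-off H r s r≢s i rewrite dec-false (r ≟ s) r≢s = refl

-- By symmetry of the codegree the product is the square of a nonzero integer. The signs match the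
-- constant part - S of the matrix X I - S.
1≤seidel² : ∀ (H : Hypergraph n k) i r s → r ≢ s →
  1ℚ ℚ.≤ (ℚ.- seq (seidel {n} {k} H r s) i) ℚ.*
           (ℚ.- seq (seidel {n} {k} H s r) i)
1≤seidel² {n} {k} H i r s r≢s = subst (1ℚ ℚ.≤_) (begin
    (z ℤ.* z) ℚ./ 1                            ≡⟨ /1-homo-* z z ⟩
    z ℚ./ 1 ℚ.* (z ℚ./ 1)
      ≡⟨ solve 1 (λ q → q :* q := (:- q) :* (:- q)) refl (z ℚ./ 1) ⟩
    (ℚ.- (z ℚ./ 1)) ℚ.* (ℚ.- (z ℚ./ 1))
      ≡⟨ cong₂ (λ p q → (ℚ.- p) ℚ.* (ℚ.- q)) rs sr ⟨
    _                                          ∎)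
  (/1-mono-≤ (z≢0⇒1≤z² z (1-2c≢0 (codegree {n} {k} H r s))))
  where
  open +-*-Solver
  open ≡-Reasoning
  z  = ℤ.1ℤ ℤ.- + (2 ℕ.* codegree {n} {k} H r s)
  rs = seidel-off {n} {k} H r s r≢s i
  sr = trans (seidel-off {n} {k} H s r (r≢s ∘ sym) i)
    (cong (λ c → (ℤ.1ℤ ℤ.- + (2 ℕ.* c)) ℚ./ 1) (codegree-sym {n} {k} H s r))

-- Seidel energy

-- The hypothesis gives - 4 h ≥ 2 v² - 2 v = v² + v (v - 2), and v ≥ 2.
n²≤-4h : ∀ m h → let v = + suc (suc m) ℚ./ 1 in
  v ℚ.* v ℚ.+ 2ℚ ℚ.* h ℚ.≤ v → v ℚ.* v ℚ.≤ ℚ.- (4ℚ ℚ.* h)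
n²≤-4h m h p = ≤-from-slack
  (2ℚ ℚ.* (v ℚ.- (v ℚ.* v ℚ.+ 2ℚ ℚ.* h)) ℚ.+ v ℚ.* (v ℚ.- 2ℚ))
  (0≤+ (0≤* (ℚₚ.nonNegative⁻¹ 2ℚ) (0≤q-p p)) (0≤* 0≤v (0≤q-p 2≤v)))
  (solve 2 (λ v h →
    v :* v :+ (con 2ℚ :* (v :- (v :* v :+ con 2ℚ :* h)) :+ v :* (v :- con 2ℚ))
    := :- (con 4ℚ :* h)) refl v h)
  where
  open +-*-Solver
  v = + suc (suc m) ℚ./ 1
  0≤v : 0ℚ ℚ.≤ v
  0≤v = /1-mono-≤ {+ 0} {+ suc (suc m)} (ℤ.+≤+ z≤n)
  2≤v : 2ℚ ℚ.≤ v
  2≤v = /1-mono-≤ {+ 2} {+ suc (suc m)} (ℤ.+≤+ (s≤s (s≤s z≤n)))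

-- At a single index `h` and `e` agree only up to an error, as do `E` and `s`. The tolerance (δ /
-- 2)² turns into δ² after multiplication by 4, so v² < s² + δ² ≤ (s + δ)², and replacing `s` by `E`
-- costs another `δ`.
energy-bound : ∀ v s t e h E δ → 0ℚ ℚ.< δ → 0ℚ ℚ.≤ s →
  t ℚ.* t ℚ.≤ s ℚ.* s ℚ.+ 4ℚ ℚ.* e → v ℚ.* v ℚ.≤ ℚ.- (4ℚ ℚ.* h) →
  ℚ.∣ h ℚ.- e ∣ ℚ.< (½ ℚ.* δ) ℚ.* (½ ℚ.* δ) → ℚ.∣ E ℚ.- s ∣ ℚ.< δ →
  v ℚ.< E ℚ.+ 2ℚ ℚ.* δ
energy-bound v s t e h E δ 0<δ 0≤s t²≤ v²≤ h≈e E≈s = begin-strict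
  v                 <⟨ square-cancel-< 0≤s+δ v²<[s+δ]² ⟩
  s ℚ.+ δ           <⟨ <-from-slack (δ ℚ.- ℚ.- (E ℚ.- s)) (0<q-p -[E-s]<δ)
                         (solve 3 (λ s d E →
                           (s :+ d) :+ (d :- :- (E :- s)) := E :+ con 2ℚ :* d)
                           refl s δ E) ⟩
  E ℚ.+ 2ℚ ℚ.* δ    ∎
  where
  open +-*-Solver
  open ℚₚ.≤-Reasoning
  0≤δ = ℚₚ.<⇒≤ 0<δ
  0≤s+δ = 0≤+ 0≤s 0≤δ
  -[E-s]<δ : ℚ.- (E ℚ.- s) ℚ.< δ
  -[E-s]<δ = ℚₚ.≤-<-trans (-p≤∣p∣ (E ℚ.- s)) E≈s
  η = (½ ℚ.* δ) ℚ.* (½ ℚ.* δ)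
  e-h<η : ℚ.- (h ℚ.- e) ℚ.< η
  e-h<η = ℚₚ.≤-<-trans (-p≤∣p∣ (h ℚ.- e)) h≈e
  v²<[s+δ]² : v ℚ.* v ℚ.< (s ℚ.+ δ) ℚ.* (s ℚ.+ δ)
  v²<[s+δ]² = <-from-slack
    (4ℚ ℚ.* (η ℚ.- ℚ.- (h ℚ.- e)) ℚ.+
      ((ℚ.- (4ℚ ℚ.* h) ℚ.- v ℚ.* v) ℚ.+
       (((s ℚ.* s ℚ.+ 4ℚ ℚ.* e) ℚ.- t ℚ.* t) ℚ.+
        (t ℚ.* t ℚ.+ 2ℚ ℚ.* (s ℚ.* δ)))))
    (ℚₚ.+-mono-<-≤ (0<* (ℚₚ.positive⁻¹ 4ℚ) (0<q-p e-h<η))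
      (0≤+ (0≤q-p v²≤) (0≤+ (0≤q-p t²≤)
        (0≤+ (0≤p² t) (0≤* (ℚₚ.nonNegative⁻¹ 2ℚ) (0≤* 0≤s 0≤δ))))))
    (solve 6 (λ v s t e h d →
      v :* v :+ (con 4ℚ :* ((con ½ :* d) :* (con ½ :* d) :- :- (h :- e)) :+
        ((:- (con 4ℚ :* h) :- v :* v) :+
         (((s :* s :+ con 4ℚ :* e) :- t :* t) :+ (t :* t :+ con 2ℚ :* (s :* d)))))
      := (s :+ d) :* (s :+ d)) refl v s t e h δ)

nonHypoenergetic-2+ : ∀ m k H → SeidelNonHypoenergetic (suc (suc m)) k H
nonHypoenergetic-2+ m k H E (ρ , charpoly≈∏ , E≈∑) ε 0<ε =
  -- Index `m` is the degree n - 2.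
  choose (charpoly≈∏ m _ (0<* 0<½δ 0<½δ)) (E≈∑ δ 0<δ)
  where
  2+m = suc (suc m)
  S = seidel {2+m} {k} H
  h = hollowMinors₂ (λ r s → -ᴿ S r s)
  -- `energy-bound` loses 2 δ in total.
  δ = ½ ℚ.* ε
  η = (½ ℚ.* δ) ℚ.* (½ ℚ.* δ)
  0<δ : 0ℚ ℚ.< δ
  0<δ = 0<* (ℚₚ.positive⁻¹ ½) 0<ε
  0<½δ : 0ℚ ℚ.< ½ ℚ.* δ
  0<½δ = 0<* (ℚₚ.positive⁻¹ ½) 0<δ
  choose : _ → (∃[ N ] ∀ i → N ≤ i →
             ℚ.∣ seq E i ℚ.- seq (∑ (λ j → ∣ ρ j ∣ᴿ)) i ∣ ℚ.< δ) →
           ∃[ N ] ∀ i → N ≤ i → + 2+m ℚ./ 1 ℚ.< seq E i ℚ.+ ε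
  choose (M , charpoly<) (N , E<) = M ℕ.⊔ N , λ i M⊔N≤i →
    subst (λ d → + 2+m ℚ./ 1 ℚ.< seq E i ℚ.+ d)
      (solve 1 (λ ε → con 2ℚ :* (con ½ :* ε) := ε) refl ε)
      (energy-bound (+ 2+m ℚ./ 1) (seq (∑ (λ j → ∣ ρ j ∣ᴿ)) i) (seq (∑ ρ) i)
        (seq (e₂ ρ) i) (seq h i) (seq E i) δ 0<δ (0≤∑∣∣ ρ i)
        ([∑]²≤[∑∣∣]²+4e₂ ρ i)
        (n²≤-4h m (seq h i)
          (hollowMinors₂-≤ (λ r s → -ᴿ S r s) i (1≤seidel² {2+m} {k} H i)))
        -- At index m + 2 the two prefixed zeros reduce away, leaving the coefficients of index `m`
        -- that `charpoly<` compares.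
        (subst₂ (λ p q → ℚ.∣ p ℚ.- q ∣ ℚ.< η)
          (coeff-charpoly-hollow S (seidel-hollow {2+m} {k} H) i)
          (coeff-∏-e₂ ρ i)
          (charpoly< i (ℕₚ.≤-trans (ℕₚ.m≤m⊔n M N) M⊔N≤i)))
        (E< i (ℕₚ.≤-trans (ℕₚ.m≤n⊔m M N) M⊔N≤i)))
    where open +-*-Solver

nonHypoenergetic-0 : ∀ k H → SeidelNonHypoenergetic 0 k H
nonHypoenergetic-0 k H E (ρ , _ , E≈∑) ε 0<ε with E≈∑ ε 0<ε
... | N , E< = N , λ i N≤i → <-from-slack (ε ℚ.- ℚ.- (seq E i ℚ.- 0ℚ))
    (0<q-p (ℚₚ.≤-<-trans (-p≤∣p∣ (seq E i ℚ.- 0ℚ)) (E< i N≤i)))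
    (solve 2 (λ ε E → con 0ℚ :+ (ε :- :- (E :- con 0ℚ)) := E :+ ε)
      refl ε (seq E i))
  where open +-*-Solver

-- On one vertex the Seidel matrix is zero.
¬nonHypoenergetic-1 : ∀ k H → ¬ SeidelNonHypoenergetic 1 k H
¬nonHypoenergetic-1 k H nonHypo =
  -- The eigenvalue 0 gives energy 0; at tolerance 1 the claim 1 ≤ 0 becomes 1 < 0 + 1.
  let (N , 1<) = nonHypo 0ᴿ
        ((λ _ → 0ᴿ) , charpoly≈X , λ ε 0<ε → 0 , λ _ _ → 0<ε)
        1ℚ (ℚₚ.positive⁻¹ 1ℚ)
  in ℚₚ.<-irrefl refl (1< N ℕₚ.≤-refl)
  where
  charpoly≈X : Eigenvalues (seidel {1} {k} H) (λ _ → 0ᴿ)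
  charpoly≈X 0             ε 0<ε = 0 , λ _ _ → 0<ε
  charpoly≈X 1             ε 0<ε = 0 , λ _ _ → 0<ε
  charpoly≈X (suc (suc m)) ε 0<ε = 0 , λ _ _ → 0<ε

-- The answer depends on `n` alone, which makes a property quantified over real numbers decidable.
nonHypoenergetic? : ∀ n k → Decidable (SeidelNonHypoenergetic n k)
nonHypoenergetic? 0             k H = yes (nonHypoenergetic-0 k H)
nonHypoenergetic? 1             k H = no (¬nonHypoenergetic-1 k H)
nonHypoenergetic? (suc (suc m)) k H = yes (nonHypoenergetic-2+ m k H)

-- The product measure

private

  total : ∀ {A : Set} → (A → ℝ) → List A → ℝ
  total w xs = foldr _+ᴿ_ 0ᴿ (map w xs)

-- `allSubsets (suc N)` has this shape with `xs` and `ys` equal; keeping them separate lets the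
-- induction exhaust one list and then the other.
total-++-map : ∀ p {N} (xs ys : List (Subset N)) →
  total (weight p) (map (inside Vec.∷_) xs ++ map (outside Vec.∷_) ys) ≗ᴿ
    p *ᴿ total (weight p) xs +ᴿ (1ᴿ -ᴿ p) *ᴿ total (weight p) ys
total-++-map p [] [] i =
  solve 1 (λ p → con 0ℚ := p :* con 0ℚ :+ (con 1ℚ :- p) :* con 0ℚ) refl (seq p i)
  where open +-*-Solver
total-++-map p [] (y ∷ ys) i = trans
  (cong (seq (weight p (outside Vec.∷ y)) i ℚ.+_) (total-++-map p [] ys i))
  (solve 3 (λ p w t → (con 1ℚ :- p) :* w :+ (p :* con 0ℚ :+ (con 1ℚ :- p) :* t)
              := p :* con 0ℚ :+ (con 1ℚ :- p) :* (w :+ t))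
    refl (seq p i) (seq (weight p y) i) (seq (total (weight p) ys) i))
  where open +-*-Solver
total-++-map p (x ∷ xs) ys i = trans
  (cong (seq (weight p (inside Vec.∷ x)) i ℚ.+_) (total-++-map p xs ys i))
  (solve 4 (λ p w t u → p :* w :+ (p :* t :+ (con 1ℚ :- p) :* u)
              := p :* (w :+ t) :+ (con 1ℚ :- p) :* u)
    refl (seq p i) (seq (weight p x) i) (seq (total (weight p) xs) i)
         (seq (total (weight p) ys) i))
  where open +-*-Solver

total-allSubsets : ∀ p N → total (weight p) (allSubsets N) ≗ᴿ 1ᴿ
total-allSubsets p zero    i = refl
total-allSubsets p (suc N) i = trans
  (total-++-map p (allSubsets N) (allSubsets N) i)
  (trans (cong (λ t → seq p i ℚ.* t ℚ.+ (1ℚ ℚ.- seq p i) ℚ.* t)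
               (total-allSubsets p N i))
    (solve 1 (λ p → p :* con 1ℚ :+ (con 1ℚ :- p) :* con 1ℚ := con 1ℚ)
      refl (seq p i)))
  where open +-*-Solver

ℙ-certain : ∀ n k p {A} (A? : Decidable {A = Hypergraph n k} A) → (∀ H → A H) →
            ℙ n k p A? ≗ᴿ 1ᴿ
ℙ-certain n k p A? certain i = trans
  (cong (λ Hs → seq (total (weight p) Hs) i)
    (filter-all A? (universal certain (allSubsets _))))
  (total-allSubsets p (length (kSubsets n k)) i)

theorem5p21 : (k : ℕ) → 3 ≤ k →
    Σ[ nonHypo? ∈ ((n : ℕ) → Decidable (SeidelNonHypoenergetic n k)) ]
    ((p : ℝ) → 0ᴿ <ᴿ p → p <ᴿ 1ᴿ →
    (λ n → ℙ n k p (nonHypo? n)) ⟶ 1ᴿ)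
theorem5p21 k _ = (λ n → nonHypoenergetic? n k) , λ p _ _ ε (d , 0<d , N , d<ε) →
  -- The event is certain from n = 2 on, but impossible for n = 1. The distance to 1 is then exactly
  -- 0, so the witnesses of 0 < ε serve again.
  2 , λ where
    (suc (suc m)) (s≤s (s≤s z≤n)) → d , 0<d , N , λ i N≤i →
      subst (λ q → ℚ.∣ q ℚ.- 1ℚ ∣ ℚ.+ d ℚ.< seq ε i)
        (sym (ℙ-certain (suc (suc m)) k p (nonHypoenergetic? (suc (suc m)) k)
               (nonHypoenergetic-2+ m k) i))
        (d<ε i N≤i)
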